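{- Let $l\ge 1$ be an integer and let $S=\mathrm{conv}\{\mathbf v_0,\dots,\mathbf v_d\}\subset\mathbb R^n$ be a $d$-dimensional lattice simplex (i.e. $\mathbf v_0,\dots,\mathbf v_d\in\mathbb Z^n$ are affinely independent). If $\mathrm{relint}(S)\cap l\mathbb Z^n$ is non-empty, then it contains a point $\mathbf w$ with $$m_S(\mathbf w)\ \ge\ \frac{(8l+7)^{ -2^{d+1}}}{8}.$$
   Context: $l\mathbb Z^n$ denotes the set of integer points all of whose coordinates are divisible by $l$; $\mathrm{relint}(S)$ is the relative interior of $S$. For $\mathbf w\in S$ with barycentric coordinates $(\alpha_0,\dots,\alpha_d)$ with respect to $\mathbf v_0,\dots,\mathbf v_d$ (so $\mathbf w=\sum_i\alpha_i\mathbf v_i$, $\sum_i\alpha_i=1$, $\alpha_i\ge0$), $m_S(\mathbf w)=\min_{0\le i\le d}\alpha_i$ is the smallest barycentric coordinate. -}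

module Defs where

open import Data.Nat as ℕ using (ℕ; zero; suc)
import Data.Nat.Properties as ℕP
open import Data.Integer as ℤ using (ℤ; +_)
open import Data.Integer.Divisibility using () renaming (_∣_ to _∣ℤ_)
open import Data.Rational using (ℚ; 0ℚ; 1ℚ; _+_; _*_; _≤_; _<_; _⊓_; _/_)
open import Data.Fin using (Fin; zero; suc)
open import Data.Product using (Σ; _×_; ∃)
open import Relation.Binary.PropositionalEquality using (_≡_)

Point : ℕ → Set
Point n = Fin n → ℤ

ι : ℤ → ℚ
ι z = z / 1

Σℚ : ∀ {k} → (Fin k → ℚ) → ℚ
Σℚ {zero}  f = 0ℚ
Σℚ {suc k} f = f zero + Σℚ (λ i → f (suc i))

minℚ : ∀ {k} → (Fin (suc k) → ℚ) → ℚ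
minℚ {zero}  f = f zero
minℚ {suc k} f = f zero ⊓ minℚ (λ i → f (suc i))

-- affine independence of v₀,…,v_d (over ℚ; for lattice points this is
-- equivalent to affine independence over ℝ)
AffinelyIndependent : ∀ {n d} → (Fin (suc d) → Point n) → Set
AffinelyIndependent {n} {d} v =
  (λ′ : Fin (suc d) → ℚ) →
  Σℚ λ′ ≡ 0ℚ →
  (∀ (j : Fin n) → Σℚ (λ i → λ′ i * ι (v i j)) ≡ 0ℚ) →
  ∀ i → λ′ i ≡ 0ℚ

IsBarycentric : ∀ {n d} → (Fin (suc d) → Point n) → Point n → (Fin (suc d) → ℚ) → Set
IsBarycentric {n} v w α =
  Σℚ α ≡ 1ℚ × (∀ i → 0ℚ ≤ α i) ×
  (∀ (j : Fin n) → Σℚ (λ i → α i * ι (v i j)) ≡ ι (w j))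

-- m_S(w) computed from the barycentric coordinates α of w
mS : ∀ {d} → (Fin (suc d) → ℚ) → ℚ
mS α = minℚ α

InRelint : ∀ {n d} → (Fin (suc d) → Point n) → Point n → Set
InRelint v w = ∃ λ α → IsBarycentric v w α × (∀ i → 0ℚ < α i)

InLZ : ∀ {n} → ℕ → Point n → Set
InLZ l w = ∀ j → (+ l) ∣ℤ w j

denom : ℕ → ℕ → ℕ
denom l d = 8 ℕ.* ((7 ℕ.+ 8 ℕ.* l) ℕ.^ (2 ℕ.^ suc d))

denom-nz : ∀ l d → ℕ.NonZero (denom l d)
denom-nz l d = ℕP.m*n≢0 8 ((7 ℕ.+ 8 ℕ.* l) ℕ.^ (2 ℕ.^ suc d)) {{_}} {{ℕP.m^n≢0 (7 ℕ.+ 8 ℕ.* l) (2 ℕ.^ suc d)}}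

bound : ℕ → ℕ → ℚ
bound l d = _/_ (+ 1) (denom l d) {{denom-nz l d}}

{-# OPTIONS --safe #-}
-- Replacing barycentric coordinates α by K α + l z with integral K and z keeps the
-- point in lℤⁿ, as long as the coordinates still sum to 1.  Sort α decreasingly with
-- tail sums σᵢ = αᵢ + … + α_d, and let j be the first index with σⱼ < 1/Tⱼ, where T grows
-- doubly exponentially.  The coordinates before j are then bounded below in terms of T,
-- and Dirichlet's pigeonhole, with a number of boxes adapted to each of them, yields t ≥ 1
-- and cᵢ with all t αᵢ − cᵢ (i < j) small compared to αᵢ / l and Σ cᵢ = t.  Passing from
-- αᵢ to αᵢ + l (t αᵢ − cᵢ), with cᵢ = 0 for i ≥ j, keeps the large coordinates above the
-- bound and at least doubles the small ones.  For rational α this can only be repeated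
-- finitely often.
module Submission where

open import Defs
open import Algebra.Properties.CommutativeMonoid.Sum using (sum-permute; ∑-distrib-+)
import Algebra.Properties.Monoid.Sum as MonoidSum
import Algebra.Properties.Semiring.Sum as SemiringSum
open import Data.Fin using (Fin; zero; suc; toℕ; fromℕ<; combine)
import Data.Fin.Permutation as Perm
open Perm using (Permutation′; _⟨$⟩ʳ_; _⟨$⟩ˡ_; _∘ₚ_)
import Data.Fin.Properties as FinP
import Data.Integer as ℤ
open ℤ using (ℤ) renaming (+_ to pos)
import Data.Integer.Divisibility.Signed as ℤS
import Data.Integer.Properties as ℤP
import Data.Integer.Tactic.RingSolver as ℤSolver
open import Data.Nat
open import Data.Nat.DivMod
open import Data.Nat.Divisibility
open import Data.Nat.Properties
open import Data.Nat.Tactic.RingSolver using (solve-∀)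
open import Data.Product using (∃; ∃₂; _×_; _,_; proj₁; proj₂)
open import Data.Rational as ℚ using (ℚ; 0ℚ; 1ℚ; mkℚ)
import Data.Rational.Properties as ℚP
open import Data.Rational.Solver using (module +-*-Solver)
import Data.Rational.Unnormalised as ℚᵘ
import Data.Rational.Unnormalised.Properties as ℚᵘP
open import Data.Sum using (_⊎_; inj₁; inj₂)
open import Data.Unit using (⊤; tt)
open import Function using (_∘_)
open import Relation.Binary.PropositionalEquality
open import Relation.Nullary using (yes; no; contradiction)

open MonoidSum +-0-monoid using (sum; sum-cong-≗)
open MonoidSum *-1-monoid using () renaming (sum to product)
open MonoidSum ℤP.+-0-monoid using () renaming (sum to ℤsum)
open SemiringSum +-*-semiring using (*-distribˡ-sum; *-distribʳ-sum)

-- Sums, decreasing rearrangement and an exponential bound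

sum-mono-≤ : ∀ {n} {f g : Fin n → ℕ} → (∀ i → f i ≤ g i) → sum f ≤ sum g
sum-mono-≤ {zero}  f≤g = z≤n
sum-mono-≤ {suc n} f≤g = +-mono-≤ (f≤g zero) (sum-mono-≤ (f≤g ∘ suc))

-- Each entry is compared with all later ones and not just with its neighbour, which is the form
-- that `extend` consumes.
Descending : ∀ {n} → (Fin n → ℕ) → Set
Descending {zero}  x = ⊤
Descending {suc n} x = (∀ k → x (suc k) ≤ x zero) × Descending (x ∘ suc)

argmax : ∀ {n} (x : Fin (suc n) → ℕ) → ∃ λ m → ∀ k → x k ≤ x m
argmax {zero}  x = zero , λ { zero → ≤-refl }
argmax {suc n} x with m , x≤ ← argmax (x ∘ suc) | ≤-total (x zero) (x (suc m))
... | inj₁ p = suc m , λ { zero → p ; (suc k) → x≤ k }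
... | inj₂ p = zero , λ { zero → ≤-refl ; (suc k) → ≤-trans (x≤ k) p }

-- Selection sort. The permutation is returned because the improved coordinates have to be carried
-- back to the original order of the vertices.
sort : ∀ {n} (x : Fin n → ℕ) → ∃ λ (π : Permutation′ n) → Descending (x ∘ (π ⟨$⟩ʳ_))
sort {zero}  x = Perm.id , tt
sort {suc n} x with m , x≤ ← argmax x
               with ρ , desc ← sort (x ∘ (Perm.transpose zero m ⟨$⟩ʳ_) ∘ suc) =
  Perm.lift₀ ρ ∘ₚ Perm.transpose zero m , (λ k → x≤ _) , desc

1+n≤2^n : ∀ n → suc n ≤ 2 ^ n
1+n≤2^n zero    = ≤-refl
1+n≤2^n (suc n) = begin
  suc (suc n)   ≡⟨ +-comm 1 (suc n) ⟩
  suc n + 1     ≤⟨ +-mono-≤ (1+n≤2^n n) (m^n>0 2 n) ⟩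
  2 ^ n + 2 ^ n ≡⟨ cong (2 ^ n +_) (sym (+-identityʳ _)) ⟩
  2 ^ suc n     ∎
  where open ≤-Reasoning

-- Simultaneous Dirichlet approximation

-- Mixed-radix numbering of the boxes: a family of box indices becomes one element of a finite set,
-- to which the pigeonhole principle applies.
encode : ∀ {n} (N : Fin n → ℕ) → (∀ i → Fin (N i)) → Fin (product N)
encode {zero}  N c = zero
encode {suc n} N c = combine (c zero) (encode (N ∘ suc) (c ∘ suc))

encode-injective : ∀ {n} (N : Fin n → ℕ) {b c : ∀ i → Fin (N i)} →
                   encode N b ≡ encode N c → ∀ i → b i ≡ c i
encode-injective {suc n} N {b} {c} eq zero    = FinP.combine-injectiveˡ (b zero) _ (c zero) _ eq
encode-injective {suc n} N {b} {c} eq (suc i) =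
  encode-injective (N ∘ suc) (FinP.combine-injectiveʳ (b zero) _ (c zero) _ eq) i

same-quotient⇒close : ∀ m n D .{{_ : NonZero D}} → m / D ≡ n / D → ∣ m - n ∣ < D
same-quotient⇒close m n D eq = begin-strict
  ∣ m - n ∣                                         ≡⟨ cong₂ ∣_-_∣ (m≡m%n+[m/n]*n m D) n≡ ⟩
  ∣ m % D + (m / D) * D - (n % D + (m / D) * D) ∣   ≡⟨ cong₂ ∣_-_∣ (+-comm (m % D) _) (+-comm (n % D) _) ⟩
  ∣ (m / D) * D + m % D - ((m / D) * D + n % D) ∣   ≡⟨ ∣m+n-m+o∣≡∣n-o∣ ((m / D) * D) _ _ ⟩
  ∣ m % D - n % D ∣                                 ≤⟨ ∣m-n∣≤m⊔n (m % D) (n % D) ⟩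
  m % D ⊔ n % D                                     <⟨ ⊔-lub (m%n<n m D) (m%n<n n D) ⟩
  D                                                 ∎
  where
  open ≤-Reasoning
  n≡ : n ≡ n % D + (m / D) * D
  n≡ = trans (m≡m%n+[m/n]*n n D) (cong (λ q → n % D + q * D) (sym eq))

-- The multiples 0, ..., `product N` outnumber the `product N` boxes by one, where the residues of
-- coordinate i are cut into `N i` intervals of length D/Nᵢ. Two multiples in a common box are
-- therefore that close in every coordinate. With `N i` equal to 1 nothing is demanded of coordinate
-- i.
dirichlet : ∀ {n} D .{{_ : NonZero D}} (x N : Fin n → ℕ) → (∀ i → NonZero (N i)) →
  ∃₂ λ s t → s < t × t ≤ product N ×
    (∀ i → N i * ∣ s * x i % D - t * x i % D ∣ < D)
dirichlet D x N N≢0 =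
  let i , j , i<j , eq = FinP.pigeonhole ≤-refl (λ t → encode N (box (toℕ t)))
  in toℕ i , toℕ j , i<j , ≤-pred (FinP.toℕ<n j) , close (toℕ i) (toℕ j) eq
  where
  box-bound : ∀ t i → N i * (t * x i % D) / D < N i
  box-bound t i = m<n*o⇒m/o<n (*-monoʳ-< (N i) {{N≢0 i}} (m%n<n (t * x i) D))
  box : ℕ → ∀ i → Fin (N i)
  box t i = fromℕ< (box-bound t i)
  close : ∀ s t → encode N (box s) ≡ encode N (box t) →
          ∀ i → N i * ∣ s * x i % D - t * x i % D ∣ < D
  close s t eq i = subst (_< D) (sym (*-distribˡ-∣-∣ (N i) _ _))
    (same-quotient⇒close (N i * (s * x i % D)) (N i * (t * x i % D)) D
      (FinP.fromℕ<-injective _ _ (box-bound s i) (box-bound t i) (encode-injective N eq i)))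

-- Doubly exponential thresholds

module Threshold (l : ℕ) .{{_ : NonZero l}} where

  -- The factors 4 l 2^(1+i) are what makes the field volume of Cut an equality.
  T : ℕ → ℕ
  T zero    = 1
  T (suc i) = 4 * l * 2 ^ suc i * (T i * T i)

  T≢0 : ∀ i → NonZero (T i)
  T≢0 zero    = _
  T≢0 (suc i) = m*n≢0 (4 * l * 2 ^ suc i) (T i * T i)
    where instance
      _ = T≢0 i
      _ = m*n≢0 (T i) (T i)
      _ = m*n≢0 4 l
      _ = m^n≢0 2 (suc i)
      _ = m*n≢0 (4 * l) (2 ^ suc i)

  T-mono : ∀ n i → T i ≤ T (n + i)
  T-mono zero    i = ≤-refl
  T-mono (suc n) i = ≤-trans (T-mono n i) (≤-trans (m≤m*n t t) (m≤n*m (t * t) (4 * l * 2 ^ suc (n + i))))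
    where
    t = T (n + i)
    instance
      _ = T≢0 (n + i)
      _ = m*n≢0 4 l
      _ = m^n≢0 2 (suc (n + i))
      _ = m*n≢0 (4 * l) (2 ^ suc (n + i))

  -- The extra factor normalises the recursion: the product on the left starts at `16 * l` and is
  -- exactly squared at every step.
  T-closed : ∀ i → T i * (4 * l * 2 ^ (2 + i)) ≡ (16 * l) ^ (2 ^ i)
  T-closed zero    = base l
    where
    base : ∀ l → 1 * (4 * l * 4) ≡ 16 * l * 1
    base = solve-∀
  T-closed (suc i) = begin
    T (suc i) * (4 * l * 2 ^ (3 + i))                             ≡⟨ square l (2 ^ i) (T i) ⟩
    T i * (4 * l * 2 ^ (2 + i)) * (T i * (4 * l * 2 ^ (2 + i)))   ≡⟨ cong₂ _*_ (T-closed i) (T-closed i) ⟩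
    (16 * l) ^ (2 ^ i) * (16 * l) ^ (2 ^ i)                       ≡⟨ ^-distribˡ-+-* (16 * l) (2 ^ i) (2 ^ i) ⟨
    (16 * l) ^ (2 ^ i + 2 ^ i)                                    ≡⟨ cong (λ e → (16 * l) ^ (2 ^ i + e)) (+-identityʳ (2 ^ i)) ⟨
    (16 * l) ^ (2 ^ suc i)                                        ∎
    where
    open ≡-Reasoning
    square : ∀ l a t → 4 * l * (2 * a) * (t * t) * (4 * l * (2 * (2 * (2 * a))))
           ≡ t * (4 * l * (2 * (2 * a))) * (t * (4 * l * (2 * (2 * a))))
    square = solve-∀

  T≤denom : ∀ d → T d ≤ denom l d
  T≤denom d = begin
    T d                                ≤⟨ m≤m*n (T d) _ ⟩
    T d * (4 * l * 2 ^ (2 + d))        ≡⟨ T-closed d ⟩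
    -- Replacing `16 * l` by a square is what raises the exponent from `2 ^ d` to `2 ^ suc d`.
    (16 * l) ^ (2 ^ d)                 ≤⟨ ^-monoˡ-≤ (2 ^ d) 16l≤B² ⟩
    ((7 + 8 * l) ^ 2) ^ (2 ^ d)        ≡⟨ ^-*-assoc (7 + 8 * l) 2 (2 ^ d) ⟩
    (7 + 8 * l) ^ (2 ^ suc d)          ≤⟨ m≤n*m _ 8 ⟩
    denom l d                          ∎
    where
    open ≤-Reasoning
    instance
      _ = m*n≢0 4 l
      _ = m^n≢0 2 (2 + d)
      _ = m*n≢0 (4 * l) (2 ^ (2 + d))
    expand : ∀ l → (7 + 8 * l) * ((7 + 8 * l) * 1) ≡ 16 * l + (49 + 96 * l + 64 * (l * l))
    expand = solve-∀
    16l≤B² : 16 * l ≤ (7 + 8 * l) ^ 2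
    16l≤B² = subst (16 * l ≤_) (sym (expand l)) (m≤m+n _ _)

  -- Separation of big and small coordinates

  -- Coordinates are numerators x over the common denominator D.  The index is the number of
  -- boxes for the residue of t x modulo D.
  data Kind (D B x : ℕ) : ℕ → Set where
    small : Kind D B x 1
    big   : ∀ W → W ≤ B → 2 * D ≤ x * W → Kind D B x (l * W)

  -- Admissible distance between two residues of one coordinate: the length of a box for a big
  -- coordinate; for a small one, whose multiples are not reduced modulo `D`, the size of the
  -- largest multiple.
  Error : ∀ {D B x N} → ℕ → Kind D B x N → ℕ → Set
  Error {x = x} t small       e = e ≤ t * x
  Error {D = D} t (big W _ _) e = l * W * e ≤ D

  -- x lists the coordinates of index ≥ i; those before j = r + i are big and s is the sum of
  -- the others.
  record Cut (D d i : ℕ) {n : ℕ} (x : Fin n → ℕ) : Set where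
    field
      j r s   : ℕ
      N       : Fin n → ℕ
      kind    : ∀ k → Kind D (T j) (x k) (N k)
      j≡r+i   : j ≡ r + i
      Tj≤Td   : T j ≤ T d
      s-small : s * T j < D
      -- At `i = 0` this says that `product N * 2 ^ r` equals `T j`, which limits how far the small
      -- coordinates can travel under Dirichlet's multiples. The version for general `i` is the one
      -- that survives putting a coordinate in front.
      volume  : product N * (T i * 2 ^ (suc i * r)) ≡ T j
      sum≤    : ∀ {y} → (∀ k → x k ≤ y) → sum x ≤ r * y + s
      -- After division by 2^(r+1): the big errors sum to at most D(1/4 + 1/8 + ... + 1/2^(r+1)) =
      -- D/2 - D/2^(r+1), and the small ones to at most t s. The summand `D` on the left avoids a
      -- subtraction.
      error≤  : ∀ t (e : Fin n → ℕ) → (∀ k → Error t (kind k) (e k)) →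
                2 ^ suc r * sum e + D ≤ D * 2 ^ r + 2 ^ suc r * (t * s)

  product-ones : ∀ n → product {n} (λ _ → 1) ≡ 1
  product-ones zero    = refl
  product-ones (suc n) = trans (+-identityʳ _) (product-ones n)

  stop : ∀ {n} D d i (x : Fin n → ℕ) → T i ≤ T d → sum x * T i < D → Cut D d i x
  stop {n} D d i x Ti≤Td σ-small = record
    { j = i ; r = 0 ; s = sum x ; N = λ _ → 1
    ; kind    = λ _ → small
    ; j≡r+i   = refl
    ; Tj≤Td   = Ti≤Td
    ; s-small = σ-small
    ; volume  = trans (cong₂ (λ p e → p * (T i * 2 ^ e)) (product-ones n) (*-zeroʳ (suc i)))
                      (trans (+-identityʳ _) (*-identityʳ (T i)))
    ; sum≤    = λ _ → ≤-refl
    ; error≤  = λ t e e≤ → ≤-trans (≤-reflexive (+-comm _ D)) (+-mono-≤ (≤-reflexive (sym (*-identityʳ D)))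
        (*-monoʳ-≤ 2 (≤-trans (sum-mono-≤ e≤) (≤-reflexive (sym (*-distribˡ-sum t x))))))
    }

  extend : ∀ {n} D d i (x : Fin (suc n) → ℕ) → (∀ k → x (suc k) ≤ x zero) →
           D ≤ sum x * T i → Cut D d (suc i) (x ∘ suc) → Cut D d i x
  extend D d i x x≤ σ-large c = record
    { j = j ; r = suc r ; s = s ; N = λ { zero → l * W ; (suc k) → N k }
    ; kind    = kind′
    ; j≡r+i   = trans j≡r+i (+-suc r i)
    ; Tj≤Td   = Tj≤Td
    ; s-small = s-small
    ; volume  = volume′
    ; sum≤    = λ {y} x≤y → ≤-trans (+-mono-≤ (x≤y zero) (sum≤ (x≤y ∘ suc)))
                                     (≤-reflexive (sym (+-assoc y (r * y) s)))
    ; error≤  = error≤′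
    }
    where
    open Cut c
    open ≤-Reasoning
    -- The power of two serves twice: it absorbs the count `suc r` of big coordinates in `2D≤x₀W`,
    -- and it gives this coordinate the share D/2^(2+r) of the geometric series in `error≤′`.
    W = 2 ^ (2 + r) * T i
    Ti = T i
    x₀ = x zero

    exponent : 2 ^ (suc i * suc r) ≡ 2 ^ suc i * 2 ^ (suc i * r)
    exponent = trans (cong (2 ^_) (*-suc (suc i) r)) (^-distribˡ-+-* 2 (suc i) (suc i * r))

    volume′ : l * W * product N * (Ti * 2 ^ (suc i * suc r)) ≡ T j
    volume′ = begin-equality
      l * W * product N * (Ti * 2 ^ (suc i * suc r))                 ≡⟨ cong (λ e → l * W * product N * (Ti * e)) exponent ⟩
      l * W * product N * (Ti * (2 ^ suc i * 2 ^ (suc i * r)))       ≡⟨ rearrange l (2 ^ r) Ti (product N) (2 ^ i) (2 ^ (suc i * r)) ⟩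
      product N * (T (suc i) * (2 ^ r * 2 ^ (suc i * r)))            ≡⟨ cong (λ e → product N * (T (suc i) * e)) (^-distribˡ-+-* 2 r (suc i * r)) ⟨
      product N * (T (suc i) * 2 ^ (suc (suc i) * r))                ≡⟨ volume ⟩
      T j                                                            ∎
      where
      rearrange : ∀ l R t P A Z → l * (2 * (2 * R) * t) * P * (t * (2 * A * Z))
                ≡ P * (4 * l * (2 * A) * (t * t) * (R * Z))
      rearrange = solve-∀

    -- By `volume′`, `W` is a factor of `T j`, and the cofactor is nonzero because `T j` is.
    W≤Tj : W ≤ T j
    W≤Tj = subst (W ≤_) eq (m≤m*n W K {{m*n≢0⇒n≢0 W {{subst NonZero (sym eq) (T≢0 j)}}}})
      where
      K = l * product N * (Ti * 2 ^ (suc i * suc r))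
      move : ∀ l w p q → w * (l * p * q) ≡ l * w * p * q
      move = solve-∀
      eq : W * K ≡ T j
      eq = trans (move l W (product N) _) volume′

    2Ti≤Tj : 2 * Ti ≤ T j
    2Ti≤Tj = ≤-trans (*-monoˡ-≤ Ti (*-monoʳ-≤ 2 (m^n>0 2 (suc r)))) W≤Tj

    -- The sum of all listed coordinates is at least D/Tᵢ. The small ones supply less than half of
    -- that, since `2 * T i ≤ T j`; the other half is spread over `suc r` big coordinates, none
    -- above `x₀`.
    2D≤x₀W : 2 * D ≤ x₀ * W
    2D≤x₀W = begin
      2 * D                     ≤⟨ *-monoʳ-≤ 2 D≤ ⟩
      2 * (2 * (suc r * x₀ * Ti)) ≤⟨ *-monoʳ-≤ 2 (*-monoʳ-≤ 2 (*-monoˡ-≤ Ti (*-monoˡ-≤ x₀ (1+n≤2^n r)))) ⟩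
      2 * (2 * (2 ^ r * x₀ * Ti)) ≡⟨ rearrange (2 ^ r) x₀ Ti ⟩
      x₀ * W                    ∎
      where
      rearrange : ∀ R y t → 2 * (2 * (R * y * t)) ≡ y * (2 * (2 * R) * t)
      rearrange = solve-∀
      expand : ∀ a s t → 2 * ((a + s) * t) ≡ 2 * (a * t) + s * (2 * t)
      expand = solve-∀
      D≤ : D ≤ 2 * (suc r * x₀ * Ti)
      D≤ = +-cancelʳ-≤ D D _ (begin
        D + D                                  ≡⟨ cong (D +_) (+-identityʳ D) ⟨
        2 * D                                  ≤⟨ *-monoʳ-≤ 2 σ-large ⟩
        2 * (sum x * Ti)                       ≤⟨ *-monoʳ-≤ 2 (*-monoˡ-≤ Ti (+-monoʳ-≤ x₀ (sum≤ x≤))) ⟩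
        2 * ((x₀ + (r * x₀ + s)) * Ti)         ≡⟨ cong (λ a → 2 * (a * Ti)) (+-assoc x₀ (r * x₀) s) ⟨
        2 * ((suc r * x₀ + s) * Ti)            ≡⟨ expand (suc r * x₀) s Ti ⟩
        2 * (suc r * x₀ * Ti) + s * (2 * Ti)   ≤⟨ +-monoʳ-≤ _ (≤-trans (*-monoʳ-≤ s 2Ti≤Tj) (<⇒≤ s-small)) ⟩
        2 * (suc r * x₀ * Ti) + D              ∎)

    kind′ : ∀ k → Kind D (T j) (x k) _
    kind′ zero    = big W W≤Tj 2D≤x₀W
    kind′ (suc k) = kind k

    error≤′ : ∀ t e → (∀ k → Error t (kind′ k) (e k)) →
              2 ^ (2 + r) * sum e + D ≤ D * 2 ^ suc r + 2 ^ (2 + r) * (t * s)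
    error≤′ t e e≤ = begin
      2 ^ (2 + r) * (e zero + sum (e ∘ suc)) + D                     ≡⟨ split (2 ^ suc r) (e zero) (sum (e ∘ suc)) D ⟩
      2 ^ (2 + r) * e zero + D + 2 * (2 ^ suc r * sum (e ∘ suc))     ≤⟨ +-monoˡ-≤ _ (+-monoˡ-≤ D e₀≤) ⟩
      D + D + 2 * (2 ^ suc r * sum (e ∘ suc))                        ≡⟨ merge D (2 ^ suc r * sum (e ∘ suc)) ⟩
      2 * (2 ^ suc r * sum (e ∘ suc) + D)                            ≤⟨ *-monoʳ-≤ 2 (error≤ t (e ∘ suc) (e≤ ∘ suc)) ⟩
      2 * (D * 2 ^ r + 2 ^ suc r * (t * s))                          ≡⟨ double D (2 ^ r) (t * s) ⟩
      D * 2 ^ suc r + 2 ^ (2 + r) * (t * s)                          ∎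
      where
      split : ∀ R a b D → 2 * R * (a + b) + D ≡ 2 * R * a + D + 2 * (R * b)
      split = solve-∀
      merge : ∀ D q → D + D + 2 * q ≡ 2 * (q + D)
      merge = solve-∀
      double : ∀ D R q → 2 * (D * R + 2 * R * q) ≡ D * (2 * R) + 2 * (2 * R) * q
      double = solve-∀
      e₀≤ : 2 ^ (2 + r) * e zero ≤ D
      e₀≤ = begin
        2 ^ (2 + r) * e zero  ≤⟨ *-monoˡ-≤ (e zero) (≤-trans (m≤m*n (2 ^ (2 + r)) Ti {{T≢0 i}}) (m≤n*m W l)) ⟩
        l * W * e zero        ≤⟨ e≤ zero ⟩
        D                     ∎

  -- The search stops at the first tail sum below D/Tᵢ. It succeeds by index `d`: in decreasing
  -- order the assumed small coordinate forces the last one below the final threshold, and the last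
  -- tail sum is that coordinate alone.
  cut : ∀ {n} D d i (x : Fin (suc n) → ℕ) → n + i ≡ d → Descending x →
        (∃ λ k → x k * T d < D) → Cut D d i x
  cut {n} D d i x n+i≡d desc x-small with sum x * T i <? D
  ... | yes σ-small = stop D d i x (subst (λ m → T i ≤ T m) n+i≡d (T-mono n i)) σ-small
  cut {zero} D d i x refl desc (zero , x₀-small) | no σ-large =
    contradiction (subst (λ a → a * T d < D) (sym (+-identityʳ (x zero))) x₀-small) σ-large
  cut {suc n} D d i x n+i≡d (x≤ , desc) x-small | no σ-large =
    extend D d i x x≤ (≮⇒≥ σ-large)
      (cut D d (suc i) (x ∘ suc) (trans (+-suc n i) n+i≡d) desc (small-tail x-small))
    where
    small-tail : (∃ λ k → x k * T d < D) → ∃ λ k → x (suc k) * T d < D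
    small-tail (zero  , h) = zero , ≤-<-trans (*-monoˡ-≤ (T d) (x≤ zero)) h
    small-tail (suc k , h) = k , h

  -- Displacement of a single coordinate

  module _ {D : ℕ} .{{_ : NonZero D}} where

    -- Leaving small coordinates unreduced is the choice c = 0 for them; it makes their displacement
    -- from `s` to `t` positive.
    residue : ∀ {B x N} → Kind D B x N → ℕ → ℕ
    residue {x = x} small       t = t * x
    residue {x = x} (big _ _ _) t = t * x % D

    residue-≡ : ∀ {B x N} (κ : Kind D B x N) t → ∃ λ c → residue κ t + c * D ≡ t * x
    residue-≡ small       t = 0 , +-identityʳ _
    residue-≡ {x = x} (big _ _ _) t = t * x / D , sym (m≡m%n+[m/n]*n (t * x) D)

    residue-error : ∀ {B x N Q s t} (κ : Kind D B x N) → s ≤ t → t ≤ Q →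
      N * ∣ s * x % D - t * x % D ∣ < D → Error Q κ ∣ residue κ s - residue κ t ∣
    residue-error {x = x} {Q = Q} {s} {t} small s≤t t≤Q _ =
      ≤-trans (∣m-n∣≤m⊔n (s * x) (t * x)) (⊔-lub (*-monoˡ-≤ x (≤-trans s≤t t≤Q)) (*-monoˡ-≤ x t≤Q))
    residue-error (big _ _ _) _ _ close = <⇒≤ close

    -- A small coordinate gains l (t - s) x, which is positive. A big one is at least 2D/W and is
    -- displaced by at most D/W, so at least D/W is left, and `W ≤ B`.
    move : ∀ {B x N Q s t} (κ : Kind D B x N) → 0 < x → s < t →
      Error Q κ ∣ residue κ s - residue κ t ∣ →
      ∃ λ b → b + l * residue κ s ≡ x + l * residue κ t × (D ≤ B * b ⊎ x < b)
    move {x = x} {s = s} {t} small 0<x s<t _ = x + l * ((t ∸ s) * x) , eq , inj₂ grows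
      where
      regroup : ∀ x l p s → x + l * (p * x) + l * (s * x) ≡ x + l * ((p + s) * x)
      regroup = solve-∀
      eq : x + l * ((t ∸ s) * x) + l * (s * x) ≡ x + l * (t * x)
      eq = trans (regroup x l (t ∸ s) s) (cong (λ p → x + l * (p * x)) (m∸n+n≡m (<⇒≤ s<t)))
      grows : x < x + l * ((t ∸ s) * x)
      grows = m<m+n x (*-mono-≤ (>-nonZero⁻¹ l) (*-mono-≤ (m<n⇒0<n∸m s<t) 0<x))
    move {B = B} {x} {s = s} {t} κ@(big W W≤B 2D≤xW) 0<x s<t close = b , eq , inj₁ D≤Bb
      where
      open ≤-Reasoning
      g = residue κ s
      h = residue κ t
      distrib : ∀ l h e W → l * (h + e) * W ≡ l * h * W + l * W * e
      distrib = solve-∀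
      shift : ∀ a D → a + D + D ≡ 2 * D + a
      shift = solve-∀
      below : l * g * W + D ≤ (x + l * h) * W
      below = begin
        l * g * W + D                           ≤⟨ +-monoˡ-≤ D (*-monoˡ-≤ W (*-monoʳ-≤ l (m≤n+∣m-n∣ g h))) ⟩
        l * (h + ∣ g - h ∣) * W + D             ≡⟨ cong (_+ D) (distrib l h ∣ g - h ∣ W) ⟩
        l * h * W + l * W * ∣ g - h ∣ + D       ≤⟨ +-monoˡ-≤ D (+-monoʳ-≤ (l * h * W) close) ⟩
        l * h * W + D + D                       ≡⟨ shift (l * h * W) D ⟩
        2 * D + l * h * W                       ≤⟨ +-monoˡ-≤ _ 2D≤xW ⟩
        x * W + l * h * W                       ≡⟨ *-distribʳ-+ W x (l * h) ⟨
        (x + l * h) * W                         ∎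
      -- The truncated subtraction is exact, because `below` leaves a positive margin.
      b = x + l * h ∸ l * g
      eq : b + l * g ≡ x + l * h
      eq = m∸n+n≡m {x + l * h} {l * g} (<⇒≤ (*-cancelʳ-< W (l * g) (x + l * h) (<-≤-trans (m<m+n (l * g * W) (>-nonZero⁻¹ D)) below)))
      D≤Bb : D ≤ B * b
      D≤Bb = ≤-trans (+-cancelˡ-≤ (l * g * W) D (b * W) (begin
        l * g * W + D       ≤⟨ below ⟩
        (x + l * h) * W     ≡⟨ cong (_* W) eq ⟨
        (b + l * g) * W     ≡⟨ cong (_* W) (+-comm b (l * g)) ⟩
        (l * g + b) * W     ≡⟨ *-distribʳ-+ W (l * g) b ⟩
        l * g * W + b * W   ∎))
        (≤-trans (*-monoʳ-≤ b W≤B) (≤-reflexive (*-comm b B)))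

    -- The replacement of α by K α + l z, multiplied by `D`. Only `z` is quantified here, since `K`
    -- must be common to all coordinates.
    Reaches : ℤ → ℕ → ℕ → Set
    Reaches K a b = ∃ λ z → pos b ≡ K ℤ.* pos a ℤ.+ pos (l * D) ℤ.* z

    -- The multiplier involves only `s` and `t`, hence is the same for every coordinate; the
    -- multiples of `D` removed in forming the residues make up the integral shift.
    move-reaches : ∀ {x b g h} c e s t → b + l * g ≡ x + l * h →
      g + c * D ≡ s * x → h + e * D ≡ t * x →
      Reaches (pos 1 ℤ.+ pos l ℤ.* (pos t ℤ.- pos s)) x b
    move-reaches {x} {b} {g} {h} c e s t bg gc he = pos c ℤ.- pos e , (begin
      pos b
        ≡⟨ isolate (pos b) (pos l) (pos g) ⟩
      (pos b ℤ.+ pos l ℤ.* pos g) ℤ.- pos l ℤ.* pos g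
        ≡⟨ cong (λ u → u ℤ.- pos l ℤ.* pos g) (lift b l g x h bg) ⟩
      (pos x ℤ.+ pos l ℤ.* pos h) ℤ.- pos l ℤ.* pos g
        ≡⟨ reveal (pos x) (pos l) (pos g) (pos h) (pos c) (pos e) (pos D) ⟩
      pos x ℤ.+ pos l ℤ.* ((pos h ℤ.+ pos e ℤ.* pos D) ℤ.- (pos g ℤ.+ pos c ℤ.* pos D)) ℤ.+ (pos l ℤ.* pos D) ℤ.* (pos c ℤ.- pos e)
        ≡⟨ cong₂ (λ p q → pos x ℤ.+ pos l ℤ.* (p ℤ.- q) ℤ.+ (pos l ℤ.* pos D) ℤ.* (pos c ℤ.- pos e)) (lift′ h e t x he) (lift′ g c s x gc) ⟩
      pos x ℤ.+ pos l ℤ.* (pos t ℤ.* pos x ℤ.- pos s ℤ.* pos x) ℤ.+ (pos l ℤ.* pos D) ℤ.* (pos c ℤ.- pos e)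
        ≡⟨ collect (pos x) (pos l) (pos s) (pos t) (pos D) (pos c ℤ.- pos e) ⟩
      (pos 1 ℤ.+ pos l ℤ.* (pos t ℤ.- pos s)) ℤ.* pos x ℤ.+ (pos l ℤ.* pos D) ℤ.* (pos c ℤ.- pos e)
        ≡⟨ cong (λ m → (pos 1 ℤ.+ pos l ℤ.* (pos t ℤ.- pos s)) ℤ.* pos x ℤ.+ m ℤ.* (pos c ℤ.- pos e)) (ℤP.pos-* l D) ⟨
      (pos 1 ℤ.+ pos l ℤ.* (pos t ℤ.- pos s)) ℤ.* pos x ℤ.+ pos (l * D) ℤ.* (pos c ℤ.- pos e) ∎)
      where
      open ≡-Reasoning
      isolate : ∀ b l g → b ≡ (b ℤ.+ l ℤ.* g) ℤ.- l ℤ.* g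
      isolate = ℤSolver.solve-∀
      reveal : ∀ x l g h c e D → (x ℤ.+ l ℤ.* h) ℤ.- l ℤ.* g ≡
        x ℤ.+ l ℤ.* ((h ℤ.+ e ℤ.* D) ℤ.- (g ℤ.+ c ℤ.* D)) ℤ.+ (l ℤ.* D) ℤ.* (c ℤ.- e)
      reveal = ℤSolver.solve-∀
      collect : ∀ x l s t D z → x ℤ.+ l ℤ.* (t ℤ.* x ℤ.- s ℤ.* x) ℤ.+ (l ℤ.* D) ℤ.* z ≡
        (pos 1 ℤ.+ l ℤ.* (t ℤ.- s)) ℤ.* x ℤ.+ (l ℤ.* D) ℤ.* z
      collect = ℤSolver.solve-∀
      lift : ∀ b l g x h → b + l * g ≡ x + l * h → pos b ℤ.+ pos l ℤ.* pos g ≡ pos x ℤ.+ pos l ℤ.* pos h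
      lift b l g x h eq = trans (cong (ℤ._+_ (pos b)) (sym (ℤP.pos-* l g)))
        (trans (cong pos eq) (cong (ℤ._+_ (pos x)) (ℤP.pos-* l h)))
      lift′ : ∀ h e t x → h + e * D ≡ t * x → pos h ℤ.+ pos e ℤ.* pos D ≡ pos t ℤ.* pos x
      lift′ h e t x eq = trans (cong (ℤ._+_ (pos h)) (sym (ℤP.pos-* e D)))
        (trans (cong pos eq) (ℤP.pos-* t x))

    -- One improvement step for all coordinates

    Improves : ℕ → ℕ → ℕ → Set
    Improves B a b = D ≤ B * b ⊎ a < b

    module Improvement {d} (x : Fin (suc d) → ℕ) (Σx≡D : sum x ≡ D) (0<x : ∀ k → 0 < x k)
                       (cut : Cut D d 0 x) where

      open Cut cut renaming (s to tail)
      Q = product N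

      N≢0 : ∀ k → NonZero (N k)
      N≢0 k = kind≢0 (kind k)
        where
        kind≢0 : ∀ {x N} → Kind D (T j) x N → NonZero N
        kind≢0 small = _
        kind≢0 {x} (big zero W≤ h) = contradiction (≤-trans (m≤n*m D 2) (≤-trans h (≤-reflexive (*-zeroʳ x)))) (<⇒≱ (>-nonZero⁻¹ D))
        kind≢0 (big (suc W) _ _) = m*n≢0 l (suc W)

      weaken : ∀ {a b} → Improves (T j) a b → Improves (T d) a b
      weaken {b = b} (inj₁ p) = inj₁ (≤-trans p (*-monoˡ-≤ b Tj≤Td))
      weaken         (inj₂ p) = inj₂ p

      -- With no big coordinate, the tail would be the whole sum `D`, while the threshold `T 0 = 1`
      -- puts it strictly below `D`.
      r-positive : ∀ {r j} → j ≡ r + 0 → tail * T j < D → sum x ≤ r * D + tail → 1 ≤ r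
      r-positive {zero}  refl tail< Σx≤ = contradiction
        (≤-trans (≤-reflexive (sym Σx≡D)) Σx≤) (<⇒≱ (subst (_< D) (*-identityʳ tail) tail<))
      r-positive {suc r} _    _     _   = s≤s z≤n

      x≤sum : ∀ {n} (x : Fin n → ℕ) k → x k ≤ sum x
      x≤sum x zero    = m≤m+n _ _
      x≤sum x (suc k) = ≤-trans (x≤sum (x ∘ suc) k) (m≤n+m _ _)

      1≤r : 1 ≤ r
      1≤r = r-positive j≡r+i s-small (sum≤ (λ k → subst (x k ≤_) Σx≡D (x≤sum x k)))

      -- `volume` gives `Q * 2 ^ r` equal to `T j`, and `1≤r` secures the factor 2.
      2Qs<D : 2 * (Q * tail) < D
      2Qs<D = begin-strict
        2 * (Q * tail)                          ≡⟨ rearrange Q tail ⟩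
        tail * (Q * (1 * 2))                    ≤⟨ *-monoʳ-≤ tail (*-monoʳ-≤ Q (*-monoʳ-≤ 1 (^-monoʳ-≤ 2 {1} (m≤n⇒m≤n+o 0 1≤r)))) ⟩
        tail * (Q * (1 * 2 ^ (1 * r)))          ≡⟨ cong (tail *_) volume ⟩
        tail * T j                              <⟨ s-small ⟩
        D                                       ∎
        where
        open ≤-Reasoning
        rearrange : ∀ Q s → 2 * (Q * s) ≡ s * (Q * (1 * 2))
        rearrange = solve-∀

      -- The big coordinates stay below D/2 by the geometric series, the small ones by `2Qs<D`.
      total-error : ∀ (e : Fin (suc d) → ℕ) → (∀ k → Error Q (kind k) (e k)) → sum e < D
      total-error e e≤ = *-cancelˡ-< (2 ^ suc r) (sum e) D (+-cancelʳ-< D _ _ (begin-strict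
        2 ^ suc r * sum e + D                     ≤⟨ error≤ Q e e≤ ⟩
        D * 2 ^ r + 2 ^ suc r * (Q * tail)        ≡⟨ rearrange D (2 ^ r) (Q * tail) ⟩
        D * 2 ^ r + 2 ^ r * (2 * (Q * tail))      <⟨ +-monoʳ-< (D * 2 ^ r) (*-monoʳ-< (2 ^ r) {{m^n≢0 2 r}} 2Qs<D) ⟩
        D * 2 ^ r + 2 ^ r * D                     ≡⟨ double D (2 ^ r) ⟩
        2 ^ suc r * D                             ≤⟨ m≤m+n _ D ⟩
        2 ^ suc r * D + D                         ∎))
        where
        open ≤-Reasoning
        rearrange : ∀ D R q → D * R + 2 * R * q ≡ D * R + R * (2 * q)
        rearrange = solve-∀
        double : ∀ D R → D * R + R * D ≡ 2 * R * D
        double = solve-∀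

      sum-∣-∣ : ∀ {n} (g h : Fin n → ℕ) → sum g ≤ sum h + sum (λ k → ∣ g k - h k ∣)
      sum-∣-∣ g h = ≤-trans (sum-mono-≤ (λ k → m≤n+∣m-n∣ (g k) (h k)))
                            (≤-reflexive (∑-distrib-+ +-0-commutativeMonoid h _))

      -- The multiples `t * x k` add up to `t * D`, and every residue differs from its multiple by a
      -- multiple of `D`.
      D∣residues : ∀ t (c g : Fin (suc d) → ℕ) → (∀ k → g k + c k * D ≡ t * x k) → D ∣ sum g
      D∣residues t c g eq = ∣m+n∣m⇒∣n (subst (D ∣_) (sym (trans (+-comm (sum c * D) (sum g)) total)) (n∣m*n t)) (n∣m*n (sum c))
        where
        open ≡-Reasoning
        total : sum g + sum c * D ≡ t * D
        total = begin
          sum g + sum c * D               ≡⟨ cong (sum g +_) (*-distribʳ-sum D c) ⟩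
          sum g + sum (λ k → c k * D)     ≡⟨ ∑-distrib-+ +-0-commutativeMonoid g (λ k → c k * D) ⟨
          sum (λ k → g k + c k * D)       ≡⟨ sum-cong-≗ eq ⟩
          sum (λ k → t * x k)             ≡⟨ *-distribˡ-sum t x ⟨
          t * sum x                       ≡⟨ cong (t *_) Σx≡D ⟩
          t * D                           ∎

      multiples-≤ : ∀ {p q e} → D ∣ p → D ∣ q → p ≤ q + e → e < D → p ≤ q
      multiples-≤ {e = e} (divides-refl p) (divides-refl q) p≤ e<D = *-monoˡ-≤ D (≤-pred (*-cancelʳ-< D p (suc q)
        (≤-<-trans p≤ (subst (q * D + e <_) (+-comm (q * D) D) (+-monoʳ-< (q * D) e<D)))))

      -- Two multiples of `D` at distance less than `D` coincide. Equivalently, the differences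
      -- `f k - c k` add up to t - s, which is what preserves the sum of the coordinates.
      sum-residues : ∀ s t (c f g h : Fin (suc d) → ℕ) →
        (∀ k → g k + c k * D ≡ s * x k) → (∀ k → h k + f k * D ≡ t * x k) →
        sum (λ k → ∣ g k - h k ∣) < D → sum g ≡ sum h
      sum-residues s t c f g h gc hf close = ≤-antisym
        (multiples-≤ D∣g D∣h (sum-∣-∣ g h) close)
        (multiples-≤ D∣h D∣g (sum-∣-∣ h g)
          (subst (_< D) (sum-cong-≗ (λ k → ∣-∣-comm (g k) (h k))) close))
        where
        D∣g = D∣residues s c g gc
        D∣h = D∣residues t f h hf

      sum-preserved : ∀ (y g h : Fin (suc d) → ℕ) → (∀ k → y k + l * g k ≡ x k + l * h k) →
        sum g ≡ sum h → sum y ≡ D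
      sum-preserved y g h eq Σg≡Σh = +-cancelʳ-≡ (l * sum g) (sum y) D (begin
        sum y + l * sum g               ≡⟨ cong (sum y +_) (*-distribˡ-sum l g) ⟩
        sum y + sum (λ k → l * g k)     ≡⟨ ∑-distrib-+ +-0-commutativeMonoid y (λ k → l * g k) ⟨
        sum (λ k → y k + l * g k)       ≡⟨ sum-cong-≗ eq ⟩
        sum (λ k → x k + l * h k)       ≡⟨ ∑-distrib-+ +-0-commutativeMonoid x (λ k → l * h k) ⟩
        sum x + sum (λ k → l * h k)     ≡⟨ cong₂ _+_ Σx≡D (sym (*-distribˡ-sum l h)) ⟩
        D + l * sum h                   ≡⟨ cong (λ u → D + l * u) Σg≡Σh ⟨
        D + l * sum g                   ∎)
        where open ≡-Reasoning

      move-all : ∀ s t → s < t → t ≤ Q →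
        (∀ k → N k * ∣ s * x k % D - t * x k % D ∣ < D) →
        ∃₂ λ K (y : Fin (suc d) → ℕ) → sum y ≡ D ×
          (∀ k → Reaches K (x k) (y k) × Improves (T d) (x k) (y k))
      move-all s t s<t t≤Q close =
        pos 1 ℤ.+ pos l ℤ.* (pos t ℤ.- pos s) , y ,
        sum-preserved y g h y-eq (sum-residues s t c f g h c-eq f-eq (total-error _ error)) ,
        λ k → move-reaches (c k) (f k) s t (y-eq k) (c-eq k) (f-eq k) , weaken (proj₂ (proj₂ (moved k)))
        where
        error : ∀ k → Error Q (kind k) ∣ residue (kind k) s - residue (kind k) t ∣
        error k = residue-error (kind k) (<⇒≤ s<t) t≤Q (close k)
        g h c f y : Fin (suc d) → ℕ
        g k = residue (kind k) s
        h k = residue (kind k) t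
        c k = proj₁ (residue-≡ (kind k) s)
        f k = proj₁ (residue-≡ (kind k) t)
        c-eq : ∀ k → g k + c k * D ≡ s * x k
        c-eq k = proj₂ (residue-≡ (kind k) s)
        f-eq : ∀ k → h k + f k * D ≡ t * x k
        f-eq k = proj₂ (residue-≡ (kind k) t)
        moved : ∀ k → ∃ λ b → b + l * g k ≡ x k + l * h k × (D ≤ T j * b ⊎ x k < b)
        moved k = move (kind k) (0<x k) s<t (error k)
        y k = proj₁ (moved k)
        y-eq : ∀ k → y k + l * g k ≡ x k + l * h k
        y-eq k = proj₁ (proj₂ (moved k))

      improved : ∃₂ λ K (y : Fin (suc d) → ℕ) → sum y ≡ D ×
        (∀ k → Reaches K (x k) (y k) × Improves (T d) (x k) (y k))
      improved = move-all (proj₁ w) (proj₁ (proj₂ w)) (proj₁ (proj₂ (proj₂ w)))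
        (proj₁ (proj₂ (proj₂ (proj₂ w)))) (proj₂ (proj₂ (proj₂ (proj₂ w))))
        where
        w = dirichlet D x N N≢0

    improve : ∀ {d} (a : Fin (suc d) → ℕ) → sum a ≡ D → (∀ i → 0 < a i) →
      (∃ λ i → a i * T d < D) →
      ∃₂ λ K (b : Fin (suc d) → ℕ) → sum b ≡ D ×
        (∀ i → Reaches K (a i) (b i) × Improves (T d) (a i) (b i))
    improve {d} a Σa≡D 0<a (i , a-small) = unsort (Improvement.improved x Σx≡D (λ k → 0<a (π ⟨$⟩ʳ k))
      (cut D d 0 x (+-identityʳ d) (proj₂ (sort a)) (π ⟨$⟩ˡ i , x-small)))
      where
      π = proj₁ (sort a)
      x : Fin (suc d) → ℕ
      x k = a (π ⟨$⟩ʳ k)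
      Σx≡D : sum x ≡ D
      Σx≡D = trans (sym (sum-permute +-0-commutativeMonoid a π)) Σa≡D
      x-small : x (π ⟨$⟩ˡ i) * T d < D
      x-small = subst (λ k → a k * T d < D) (sym (Perm.inverseʳ π)) a-small
      unsort : (∃₂ λ K (y : Fin (suc d) → ℕ) → sum y ≡ D ×
                  (∀ k → Reaches K (x k) (y k) × Improves (T d) (x k) (y k))) →
               ∃₂ λ K (b : Fin (suc d) → ℕ) → sum b ≡ D ×
                  (∀ i → Reaches K (a i) (b i) × Improves (T d) (a i) (b i))
      unsort (K , y , Σy≡D , y-improves) = K , (λ k → y (π ⟨$⟩ˡ k)) ,
        trans (sym (sum-permute +-0-commutativeMonoid y (Perm.flip π))) Σy≡D ,
        λ k → subst (λ k′ → Reaches K (a k′) (y (π ⟨$⟩ˡ k)) × Improves (T d) (a k′) (y (π ⟨$⟩ˡ k)))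
                    (Perm.inverseʳ π) (y-improves (π ⟨$⟩ˡ k))

    -- Iteration of the improvement step

    reaches-refl : ∀ a → Reaches (pos 1) a a
    reaches-refl a = pos 0 , lemma (pos a) (pos (l * D))
      where
      lemma : ∀ a m → a ≡ pos 1 ℤ.* a ℤ.+ m ℤ.* pos 0
      lemma = ℤSolver.solve-∀

    reaches-trans : ∀ {K L a b c} → Reaches K a b → Reaches L b c → Reaches (L ℤ.* K) a c
    reaches-trans {K} {L} {a} {b} {c} (z , b≡) (w , c≡) = L ℤ.* z ℤ.+ w , trans c≡
      (trans (cong (λ b → L ℤ.* b ℤ.+ pos (l * D) ℤ.* w) b≡) (lemma L K (pos a) (pos (l * D)) z w))
      where
      lemma : ∀ L K a m z w → L ℤ.* (K ℤ.* a ℤ.+ m ℤ.* z) ℤ.+ m ℤ.* w ≡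
              L ℤ.* K ℤ.* a ℤ.+ m ℤ.* (L ℤ.* z ℤ.+ w)
      lemma = ℤSolver.solve-∀

    Balanced : ∀ {d} → (ℕ → Set) → (Fin (suc d) → ℕ) → Set
    Balanced {d} P a = ∃₂ λ K (b : Fin (suc d) → ℕ) → sum b ≡ D ×
      (∀ i → Reaches K (a i) (b i) × 0 < b i × P (b i))

    -- The denominator `D` never changes, so a strict increase of a numerator is an increase by at
    -- least 1. A coordinate that has reached D/T_d may shrink later, but not below that value.
    iterate : ∀ {d} (a : Fin (suc d) → ℕ) → sum a ≡ D → (∀ i → 0 < a i) → ∀ n →
      Balanced (λ b → D ≤ T d * b ⊎ n ≤ b) a
    iterate a Σa≡D 0<a zero = pos 1 , a , Σa≡D , λ i → reaches-refl (a i) , 0<a i , inj₂ z≤n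
    iterate {d} a Σa≡D 0<a (suc n) = refine (iterate a Σa≡D 0<a n)
      where
      positive : ∀ {p q} → 0 < p → Improves (T d) p q → 0 < q
      positive {q = zero} 0<p (inj₁ D≤) =
        contradiction (≤-trans D≤ (≤-reflexive (*-zeroʳ (T d)))) (<⇒≱ (>-nonZero⁻¹ D))
      positive {q = suc _} _   (inj₁ _)   = s≤s z≤n
      positive             0<p (inj₂ p<q) = <-trans 0<p p<q
      raise : ∀ {p q} → D ≤ T d * p ⊎ n ≤ p → Improves (T d) p q → D ≤ T d * q ⊎ suc n ≤ q
      raise _          (inj₁ D≤)  = inj₁ D≤
      raise (inj₁ D≤)  (inj₂ p<q) = inj₁ (≤-trans D≤ (*-monoʳ-≤ (T d) (<⇒≤ p<q)))
      raise (inj₂ n≤p) (inj₂ p<q) = inj₂ (≤-<-trans n≤p p<q)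

      refine : Balanced (λ b → D ≤ T d * b ⊎ n ≤ b) a → Balanced (λ b → D ≤ T d * b ⊎ suc n ≤ b) a
      refine (K , b , Σb≡D , a→b) with FinP.any? (λ i → b i * T d <? D)
      -- `improve` asks for a coordinate below the threshold; when there is none, the current point
      -- already satisfies the first alternative everywhere.
      ... | no ¬below = K , b , Σb≡D , λ i → proj₁ (a→b i) , proj₁ (proj₂ (a→b i)) ,
        inj₁ (subst (D ≤_) (*-comm (b i) (T d)) (≮⇒≥ (λ h → ¬below (i , h))))
      ... | yes below = compose (improve b Σb≡D (λ i → proj₁ (proj₂ (a→b i))) below)
        where
        compose : (∃₂ λ L c → sum c ≡ D × (∀ i → Reaches L (b i) (c i) × Improves (T d) (b i) (c i))) →
                  Balanced (λ b → D ≤ T d * b ⊎ suc n ≤ b) a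
        compose (L , c , Σc≡D , b→c) = L ℤ.* K , c , Σc≡D , λ i →
          reaches-trans {K} {L} (proj₁ (a→b i)) (proj₁ (b→c i)) ,
          positive (proj₁ (proj₂ (a→b i))) (proj₂ (b→c i)) ,
          raise (proj₂ (proj₂ (a→b i))) (proj₂ (b→c i))

    balance : ∀ {d} (a : Fin (suc d) → ℕ) → sum a ≡ D → (∀ i → 0 < a i) →
      Balanced (λ b → D ≤ denom l d * b) a
    -- `D` rounds suffice: a numerator that has grown to `D` meets the bound because `denom l d` is
    -- at least 1.
    balance {d} a Σa≡D 0<a = finish (iterate a Σa≡D 0<a D)
      where
      large : ∀ {p} → D ≤ T d * p ⊎ D ≤ p → D ≤ denom l d * p
      large {p} (inj₁ D≤) = ≤-trans D≤ (*-monoˡ-≤ p (T≤denom d))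
      large {p} (inj₂ D≤) = ≤-trans D≤ (m≤n*m p (denom l d) {{denom-nz l d}})
      finish : Balanced (λ b → D ≤ T d * b ⊎ D ≤ b) a → Balanced (λ b → D ≤ denom l d * b) a
      finish (K , b , Σb≡D , a→b) =
        K , b , Σb≡D , λ i → proj₁ (a→b i) , proj₁ (proj₂ (a→b i)) , large (proj₂ (proj₂ (a→b i)))

-- Passage between rational barycentric coordinates and integer numerators

ι-ᵘ : ∀ z → ℚ.toℚᵘ (ι z) ℚᵘ.≃ ℚᵘ.mkℚᵘ z 0
ι-ᵘ z = ℚP.toℚᵘ-fromℚᵘ (ℚᵘ.mkℚᵘ z 0)

ι-injective : ∀ {x y} → ι x ≡ ι y → x ≡ y
ι-injective {x} {y} eq with ℚᵘ.*≡* x≡y ← ℚP./-injective-≃ (ℚᵘ.mkℚᵘ x 0) (ℚᵘ.mkℚᵘ y 0) eq =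
  trans (sym (ℤP.*-identityʳ x)) (trans x≡y (ℤP.*-identityʳ y))

ι-+ : ∀ x y → ι (x ℤ.+ y) ≡ ι x ℚ.+ ι y
ι-+ x y = ℚP.toℚᵘ-injective (begin
  ℚ.toℚᵘ (ι (x ℤ.+ y))                   ≈⟨ ι-ᵘ (x ℤ.+ y) ⟩
  ℚᵘ.mkℚᵘ (x ℤ.+ y) 0                     ≈⟨ ℚᵘ.*≡* (lemma x y) ⟩
  ℚᵘ.mkℚᵘ x 0 ℚᵘ.+ ℚᵘ.mkℚᵘ y 0            ≈⟨ ℚᵘP.+-cong (ι-ᵘ x) (ι-ᵘ y) ⟨
  ℚ.toℚᵘ (ι x) ℚᵘ.+ ℚ.toℚᵘ (ι y)          ≈⟨ ℚP.toℚᵘ-homo-+ (ι x) (ι y) ⟨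
  ℚ.toℚᵘ (ι x ℚ.+ ι y)                    ∎)
  where
  open import Relation.Binary.Reasoning.Setoid ℚᵘP.≃-setoid
  lemma : ∀ x y → (x ℤ.+ y) ℤ.* pos 1 ≡ (x ℤ.* pos 1 ℤ.+ y ℤ.* pos 1) ℤ.* pos 1
  lemma = ℤSolver.solve-∀

ι-* : ∀ x y → ι (x ℤ.* y) ≡ ι x ℚ.* ι y
ι-* x y = ℚP.toℚᵘ-injective (begin
  ℚ.toℚᵘ (ι (x ℤ.* y))                   ≈⟨ ι-ᵘ (x ℤ.* y) ⟩
  ℚᵘ.mkℚᵘ x 0 ℚᵘ.* ℚᵘ.mkℚᵘ y 0            ≈⟨ ℚᵘP.*-cong (ι-ᵘ x) (ι-ᵘ y) ⟨
  ℚ.toℚᵘ (ι x) ℚᵘ.* ℚ.toℚᵘ (ι y)          ≈⟨ ℚP.toℚᵘ-homo-* (ι x) (ι y) ⟨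
  ℚ.toℚᵘ (ι x ℚ.* ι y)                    ∎)
  where open import Relation.Binary.Reasoning.Setoid ℚᵘP.≃-setoid

/-*-ι : ∀ b D .{{_ : NonZero D}} → (b ℚ./ D) ℚ.* ι (pos D) ≡ ι b
/-*-ι b D@(suc D-1) = ℚP.toℚᵘ-injective (begin
  ℚ.toℚᵘ ((b ℚ./ D) ℚ.* ι (pos D))                 ≈⟨ ℚP.toℚᵘ-homo-* (b ℚ./ D) (ι (pos D)) ⟩
  ℚ.toℚᵘ (b ℚ./ D) ℚᵘ.* ℚ.toℚᵘ (ι (pos D))         ≈⟨ ℚᵘP.*-cong (ℚP.toℚᵘ-fromℚᵘ (ℚᵘ.mkℚᵘ b D-1)) (ι-ᵘ (pos D)) ⟩
  ℚᵘ.mkℚᵘ b D-1 ℚᵘ.* ℚᵘ.mkℚᵘ (pos D) 0             ≈⟨ ℚᵘ.*≡* (trans (ℤP.*-identityʳ (b ℤ.* pos D)) (cong (λ d → b ℤ.* pos d) (sym (*-identityʳ D)))) ⟩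
  ℚᵘ.mkℚᵘ b 0                                      ≈⟨ ι-ᵘ b ⟨
  ℚ.toℚᵘ (ι b)                                     ∎)
  where open import Relation.Binary.Reasoning.Setoid ℚᵘP.≃-setoid

Σℚ-cong : ∀ {n} {f g : Fin n → ℚ} → (∀ i → f i ≡ g i) → Σℚ f ≡ Σℚ g
Σℚ-cong {zero}  eq = refl
Σℚ-cong {suc n} eq = cong₂ ℚ._+_ (eq zero) (Σℚ-cong (eq ∘ suc))

Σℚ-linear : ∀ {n} p q (f g : Fin n → ℚ) →
  Σℚ (λ i → p ℚ.* f i ℚ.+ q ℚ.* g i) ≡ p ℚ.* Σℚ f ℚ.+ q ℚ.* Σℚ g
Σℚ-linear {zero}  p q f g = solve 2 (λ p q → con 0ℚ := p :* con 0ℚ :+ q :* con 0ℚ) refl p q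
  where open +-*-Solver
Σℚ-linear {suc n} p q f g = trans (cong (p ℚ.* f zero ℚ.+ q ℚ.* g zero ℚ.+_) (Σℚ-linear p q (f ∘ suc) (g ∘ suc)))
  (solve 6 (λ p q a b c d → p :* a :+ q :* b :+ (p :* c :+ q :* d) := p :* (a :+ c) :+ q :* (b :+ d))
    refl p q (f zero) (g zero) (Σℚ (f ∘ suc)) (Σℚ (g ∘ suc)))
  where open +-*-Solver

Σℚ-*ʳ : ∀ {n} (f : Fin n → ℚ) q → Σℚ (λ i → f i ℚ.* q) ≡ Σℚ f ℚ.* q
Σℚ-*ʳ {zero}  f q = sym (ℚP.*-zeroˡ q)
Σℚ-*ʳ {suc n} f q = trans (cong (f zero ℚ.* q ℚ.+_) (Σℚ-*ʳ (f ∘ suc) q))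
  (sym (ℚP.*-distribʳ-+ q (f zero) (Σℚ (f ∘ suc))))

Σℚ-ι : ∀ {n} (f : Fin n → ℤ) → Σℚ (ι ∘ f) ≡ ι (ℤsum f)
Σℚ-ι {zero}  f = refl
Σℚ-ι {suc n} f = trans (cong (ι (f zero) ℚ.+_) (Σℚ-ι (f ∘ suc))) (sym (ι-+ (f zero) (ℤsum (f ∘ suc))))

ℤsum-pos : ∀ {n} (f : Fin n → ℕ) → ℤsum (pos ∘ f) ≡ pos (sum f)
ℤsum-pos {zero}  f = refl
ℤsum-pos {suc n} f = cong (ℤ._+_ (pos (f zero))) (ℤsum-pos (f ∘ suc))

minℚ-glb : ∀ {n q} (f : Fin (suc n) → ℚ) → (∀ i → q ℚ.≤ f i) → q ℚ.≤ minℚ f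
minℚ-glb {zero}  f q≤ = q≤ zero
minℚ-glb {suc n} f q≤ = ℚP.⊓-glb (q≤ zero) (minℚ-glb (f ∘ suc) (q≤ ∘ suc))

-- The common denominator is the product of all denominators; each step rescales the numerators
-- found so far by the new one.
clear-denominators : ∀ {n} (α : Fin n → ℚ) → (∀ i → 0ℚ ℚ.< α i) →
  ∃ λ D → NonZero D × ∃ λ (a : Fin n → ℕ) → (∀ i → 0 < a i) × (∀ i → α i ℚ.* ι (pos D) ≡ ι (pos (a i)))
clear-denominators {zero}  α 0<α = 1 , _ , (λ ()) , (λ ()) , λ ()
clear-denominators {suc n} α 0<α
  with D , D≢0 , a , 0<a , a≡ ← clear-denominators (α ∘ suc) (0<α ∘ suc)
  -- Positivity leaves only a successor as numerator of `α zero`, so one pattern covers all cases.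
  with α zero in eq | ℚ.positive (0<α zero)
... | α₀@(mkℚ (pos (suc p)) q-1 _) | _ =
  suc q-1 * D , m*n≢0 (suc q-1) D {{_}} {{D≢0}} , b , 0<b , b≡
  where
  b : Fin (suc n) → ℕ
  b zero    = suc p * D
  b (suc i) = suc q-1 * a i
  0<b : ∀ i → 0 < b i
  0<b zero    = *-mono-≤ {1} {suc p} (s≤s z≤n) (>-nonZero⁻¹ D {{D≢0}})
  0<b (suc i) = *-mono-≤ {1} {suc q-1} (s≤s z≤n) (0<a i)
  ι-pos-* : ∀ x y → ι (pos (x * y)) ≡ ι (pos x) ℚ.* ι (pos y)
  ι-pos-* x y = trans (cong ι (ℤP.pos-* x y)) (ι-* (pos x) (pos y))
  b≡ : ∀ i → α i ℚ.* ι (pos (suc q-1 * D)) ≡ ι (pos (b i))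
  b≡ zero = begin
    α zero ℚ.* ι (pos (suc q-1 * D))                     ≡⟨ cong₂ ℚ._*_ eq (ι-pos-* (suc q-1) D) ⟩
    α₀ ℚ.* (ι (pos (suc q-1)) ℚ.* ι (pos D))             ≡⟨ ℚP.*-assoc α₀ (ι (pos (suc q-1))) (ι (pos D)) ⟨
    α₀ ℚ.* ι (pos (suc q-1)) ℚ.* ι (pos D)               ≡⟨ cong (λ β → β ℚ.* ι (pos (suc q-1)) ℚ.* ι (pos D)) (ℚP.↥p/↧p≡p α₀) ⟨
    (pos (suc p) ℚ./ suc q-1) ℚ.* ι (pos (suc q-1)) ℚ.* ι (pos D) ≡⟨ cong (ℚ._* ι (pos D)) (/-*-ι (pos (suc p)) (suc q-1)) ⟩
    ι (pos (suc p)) ℚ.* ι (pos D)                        ≡⟨ ι-pos-* (suc p) D ⟨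
    ι (pos (suc p * D))                                  ∎
    where open ≡-Reasoning
  b≡ (suc i) = begin
    α (suc i) ℚ.* ι (pos (suc q-1 * D))                  ≡⟨ cong (α (suc i) ℚ.*_) (ι-pos-* (suc q-1) D) ⟩
    α (suc i) ℚ.* (ι (pos (suc q-1)) ℚ.* ι (pos D))      ≡⟨ exchange (α (suc i)) (ι (pos (suc q-1))) (ι (pos D)) ⟩
    ι (pos (suc q-1)) ℚ.* (α (suc i) ℚ.* ι (pos D))      ≡⟨ cong (ι (pos (suc q-1)) ℚ.*_) (a≡ i) ⟩
    ι (pos (suc q-1)) ℚ.* ι (pos (a i))                  ≡⟨ ι-pos-* (suc q-1) (a i) ⟨
    ι (pos (suc q-1 * a i))                              ∎
    where
    open ≡-Reasoning
    exchange : ∀ x y z → x ℚ.* (y ℚ.* z) ≡ y ℚ.* (x ℚ.* z)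
    exchange = solve 3 (λ x y z → x :* (y :* z) := y :* (x :* z)) refl
      where open +-*-Solver

bound-positive : ∀ l d → 0ℚ ℚ.< bound l d
bound-positive l d = ℚP.positive⁻¹ (bound l d) {{ℚP.normalize-pos 1 (denom l d) {{denom-nz l d}}}}

1/E≤b/D : ∀ {b D E} .{{_ : NonZero D}} .{{_ : NonZero E}} → D ≤ E * b → pos 1 ℚ./ E ℚ.≤ pos b ℚ./ D
1/E≤b/D {b} {D@(suc D-1)} {E@(suc E-1)} D≤Eb = ℚP.toℚᵘ-cancel-≤ (begin
  ℚ.toℚᵘ (pos 1 ℚ./ E)   ≃⟨ ℚP.toℚᵘ-fromℚᵘ (ℚᵘ.mkℚᵘ (pos 1) E-1) ⟩
  ℚᵘ.mkℚᵘ (pos 1) E-1    ≤⟨ ℚᵘ.*≤* (subst₂ ℤ._≤_ (sym (ℤP.*-identityˡ (pos D))) (trans (cong pos (*-comm E b)) (ℤP.pos-* b E)) (ℤ.+≤+ D≤Eb)) ⟩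
  ℚᵘ.mkℚᵘ (pos b) D-1    ≃⟨ ℚP.toℚᵘ-fromℚᵘ (ℚᵘ.mkℚᵘ (pos b) D-1) ⟨
  ℚ.toℚᵘ (pos b ℚ./ D)   ∎)
  where open ℚᵘP.≤-Reasoning

-- Allows equations between coordinates to be checked on numerators, where all terms come from
-- integers.
ι-cancelʳ : ∀ D .{{_ : NonZero D}} {x y} → x ℚ.* ι (pos D) ≡ y ℚ.* ι (pos D) → x ≡ y
ι-cancelʳ D {x} {y} eq = trans (undo x) (trans (cong (ℚ._* (pos 1 ℚ./ D)) eq) (sym (undo y)))
  where
  undo : ∀ x → x ≡ x ℚ.* ι (pos D) ℚ.* (pos 1 ℚ./ D)
  undo x = begin
    x                                     ≡⟨ ℚP.*-identityʳ x ⟨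
    x ℚ.* 1ℚ                              ≡⟨ cong (x ℚ.*_) (/-*-ι (pos 1) D) ⟨
    x ℚ.* ((pos 1 ℚ./ D) ℚ.* ι (pos D))   ≡⟨ cong (x ℚ.*_) (ℚP.*-comm (pos 1 ℚ./ D) (ι (pos D))) ⟩
    x ℚ.* (ι (pos D) ℚ.* (pos 1 ℚ./ D))   ≡⟨ ℚP.*-assoc x (ι (pos D)) (pos 1 ℚ./ D) ⟨
    x ℚ.* ι (pos D) ℚ.* (pos 1 ℚ./ D)     ∎
    where open ≡-Reasoning

open Threshold

-- The lattice point with the improved coordinates

module Realization {l D n d : ℕ} .{{_ : NonZero l}} .{{D≢0 : NonZero D}}
  (v : Fin (suc d) → Point n) (w : Point n) (l∣w : InLZ l w)
  (α : Fin (suc d) → ℚ) (α-barycentric : IsBarycentric v w α)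
  (a b : Fin (suc d) → ℕ) (a≡ : ∀ i → α i ℚ.* ι (pos D) ≡ ι (pos (a i)))
  (K : ℤ) (a→b : ∀ i → Reaches l {D} K (a i) (b i)) (Σb≡D : sum b ≡ D)
  (b-large : ∀ i → D ≤ denom l d * b i) where

  z : Fin (suc d) → ℤ
  z i = proj₁ (a→b i)

  β : Fin (suc d) → ℚ
  β i = pos (b i) ℚ./ D

  -- Written through `w` and the vertices instead of `β`, so that integrality and divisibility by
  -- `l` are visible at once.
  w′ : Point n
  w′ j = K ℤ.* w j ℤ.+ pos l ℤ.* ℤsum (λ i → z i ℤ.* v i j)

  w′∈lℤⁿ : InLZ l w′
  w′∈lℤⁿ j = ℤS.∣⇒∣ᵤ (ℤS.∣m∣n⇒∣m+n (ℤS.∣n⇒∣m*n K (ℤS.∣ᵤ⇒∣ {pos l} (l∣w j)))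
                                   (ℤS.∣m⇒∣m*n (ℤsum (λ i → z i ℤ.* v i j)) ℤS.∣-refl))

  β≡ : ∀ i → β i ≡ ι K ℚ.* α i ℚ.+ ι (pos l) ℚ.* ι (z i)
  β≡ i = ι-cancelʳ D (begin
    β i ℚ.* ι (pos D)
      ≡⟨ /-*-ι (pos (b i)) D ⟩
    ι (pos (b i))
      ≡⟨ cong ι (proj₂ (a→b i)) ⟩
    ι (K ℤ.* pos (a i) ℤ.+ pos (l * D) ℤ.* z i)
      ≡⟨ ι-+ (K ℤ.* pos (a i)) (pos (l * D) ℤ.* z i) ⟩
    ι (K ℤ.* pos (a i)) ℚ.+ ι (pos (l * D) ℤ.* z i)
      ≡⟨ cong₂ ℚ._+_ (ι-* K (pos (a i))) (ι-* (pos (l * D)) (z i)) ⟩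
    ι K ℚ.* ι (pos (a i)) ℚ.+ ι (pos (l * D)) ℚ.* ι (z i)
      ≡⟨ cong₂ (λ p q → ι K ℚ.* p ℚ.+ q ℚ.* ι (z i)) (sym (a≡ i)) (trans (cong ι (ℤP.pos-* l D)) (ι-* (pos l) (pos D))) ⟩
    ι K ℚ.* (α i ℚ.* ι (pos D)) ℚ.+ ι (pos l) ℚ.* ι (pos D) ℚ.* ι (z i)
      ≡⟨ factor (ι K) (α i) (ι (pos D)) (ι (pos l)) (ι (z i)) ⟩
    (ι K ℚ.* α i ℚ.+ ι (pos l) ℚ.* ι (z i)) ℚ.* ι (pos D) ∎)
    where
    open ≡-Reasoning
    factor : ∀ k a D l z → k ℚ.* (a ℚ.* D) ℚ.+ l ℚ.* D ℚ.* z ≡ (k ℚ.* a ℚ.+ l ℚ.* z) ℚ.* D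
    factor = solve 5 (λ k a D l z → k :* (a :* D) :+ l :* D :* z := (k :* a :+ l :* z) :* D) refl
      where open +-*-Solver

  Σβ≡1 : Σℚ β ≡ 1ℚ
  Σβ≡1 = ι-cancelʳ D (begin
    Σℚ β ℚ.* ι (pos D)            ≡⟨ Σℚ-*ʳ β (ι (pos D)) ⟨
    Σℚ (λ i → β i ℚ.* ι (pos D))  ≡⟨ Σℚ-cong (λ i → /-*-ι (pos (b i)) D) ⟩
    Σℚ (λ i → ι (pos (b i)))      ≡⟨ Σℚ-ι (pos ∘ b) ⟩
    ι (ℤsum (pos ∘ b))            ≡⟨ cong ι (ℤsum-pos b) ⟩
    ι (pos (sum b))               ≡⟨ cong (ι ∘ pos) Σb≡D ⟩
    ι (pos D)                     ≡⟨ ℚP.*-identityˡ (ι (pos D)) ⟨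
    1ℚ ℚ.* ι (pos D)              ∎)
    where open ≡-Reasoning

  -- By linearity and `β≡`: `K` times the representation of `w`, plus `l` times an integral
  -- combination of the vertices.
  Σβv≡w′ : ∀ j → Σℚ (λ i → β i ℚ.* ι (v i j)) ≡ ι (w′ j)
  Σβv≡w′ j = begin
    Σℚ (λ i → β i ℚ.* ι (v i j))
      ≡⟨ Σℚ-cong (λ i → trans (cong (ℚ._* ι (v i j)) (β≡ i)) (expand (ι K) (α i) (ι (pos l)) (ι (z i)) (ι (v i j)))) ⟩
    Σℚ (λ i → ι K ℚ.* (α i ℚ.* ι (v i j)) ℚ.+ ι (pos l) ℚ.* (ι (z i) ℚ.* ι (v i j)))
      ≡⟨ Σℚ-linear (ι K) (ι (pos l)) (λ i → α i ℚ.* ι (v i j)) (λ i → ι (z i) ℚ.* ι (v i j)) ⟩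
    ι K ℚ.* Σℚ (λ i → α i ℚ.* ι (v i j)) ℚ.+ ι (pos l) ℚ.* Σℚ (λ i → ι (z i) ℚ.* ι (v i j))
      ≡⟨ cong₂ (λ p q → ι K ℚ.* p ℚ.+ ι (pos l) ℚ.* q) (proj₂ (proj₂ α-barycentric) j)
           (trans (Σℚ-cong (λ i → sym (ι-* (z i) (v i j)))) (Σℚ-ι (λ i → z i ℤ.* v i j))) ⟩
    ι K ℚ.* ι (w j) ℚ.+ ι (pos l) ℚ.* ι (ℤsum (λ i → z i ℤ.* v i j))
      ≡⟨ cong₂ ℚ._+_ (ι-* K (w j)) (ι-* (pos l) (ℤsum (λ i → z i ℤ.* v i j))) ⟨
    ι (K ℤ.* w j) ℚ.+ ι (pos l ℤ.* ℤsum (λ i → z i ℤ.* v i j))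
      ≡⟨ ι-+ (K ℤ.* w j) (pos l ℤ.* ℤsum (λ i → z i ℤ.* v i j)) ⟨
    ι (w′ j) ∎
    where
    open ≡-Reasoning
    expand : ∀ k a l z v → (k ℚ.* a ℚ.+ l ℚ.* z) ℚ.* v ≡ k ℚ.* (a ℚ.* v) ℚ.+ l ℚ.* (z ℚ.* v)
    expand = solve 5 (λ k a l z v → (k :* a :+ l :* z) :* v := k :* (a :* v) :+ l :* (z :* v)) refl
      where open +-*-Solver

  bound≤β : ∀ i → bound l d ℚ.≤ β i
  bound≤β i = 1/E≤b/D {b i} {D} {denom l d} {{D≢0}} {{denom-nz l d}} (b-large i)

  0<β : ∀ i → 0ℚ ℚ.< β i
  0<β i = ℚP.<-≤-trans (bound-positive l d) (bound≤β i)

  realized : ∃ λ (w : Point n) → InLZ l w ×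
    (∃ λ α → IsBarycentric v w α × (∀ i → 0ℚ ℚ.< α i) × bound l d ℚ.≤ mS α)
  realized = w′ , w′∈lℤⁿ , β , (Σβ≡1 , (λ i → ℚP.<⇒≤ (0<β i)) , Σβv≡w′) , 0<β , minℚ-glb β bound≤β

numerators-sum : ∀ {n D} {α : Fin n → ℚ} {a : Fin n → ℕ} → Σℚ α ≡ 1ℚ →
  (∀ i → α i ℚ.* ι (pos D) ≡ ι (pos (a i))) → sum a ≡ D
numerators-sum {D = D} {α} {a} Σα≡1 a≡ = ℤP.+-injective (ι-injective (begin
  ι (pos (sum a))               ≡⟨ cong ι (ℤsum-pos a) ⟨
  ι (ℤsum (pos ∘ a))            ≡⟨ Σℚ-ι (pos ∘ a) ⟨
  Σℚ (λ i → ι (pos (a i)))      ≡⟨ Σℚ-cong a≡ ⟨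
  Σℚ (λ i → α i ℚ.* ι (pos D))  ≡⟨ Σℚ-*ʳ α (ι (pos D)) ⟩
  Σℚ α ℚ.* ι (pos D)            ≡⟨ cong (ℚ._* ι (pos D)) Σα≡1 ⟩
  1ℚ ℚ.* ι (pos D)              ≡⟨ ℚP.*-identityˡ (ι (pos D)) ⟩
  ι (pos D)                     ∎))
  where open ≡-Reasoning

theorem2 : (l n d : ℕ) → l ≥ 1 →
    (v : Fin (suc d) → Point n) → AffinelyIndependent v →
    (∃ λ (w : Point n) → InLZ l w × InRelint v w) →
    ∃ λ (w : Point n) → InLZ l w ×
    (∃ λ α → IsBarycentric v w α × (∀ i → 0ℚ ℚ.< α i) × bound l d ℚ.≤ mS α)
theorem2 l n d l≥1 v _ (w , l∣w , α , α-barycentric , 0<α) = go (clear-denominators α 0<α)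
  where
  instance
    _ = >-nonZero l≥1
  go : (∃ λ D → NonZero D × ∃ λ (a : Fin (suc d) → ℕ) → (∀ i → 0 < a i) ×
          (∀ i → α i ℚ.* ι (pos D) ≡ ι (pos (a i)))) → _
  go (D , D≢0 , a , 0<a , a≡) = realize (balance l a (numerators-sum {α = α} {a} (proj₁ α-barycentric) a≡) 0<a)
    where
    instance
      _ = D≢0
    realize : Balanced l {D} (λ b → D ≤ denom l d * b) a → _
    realize (K , b , Σb≡D , a→b) =
      Realization.realized v w l∣w α α-barycentric a b a≡ K (λ i → proj₁ (a→b i)) Σb≡D (λ i → proj₂ (proj₂ (a→b i)))
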